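{- Let $G$ be a graph and let $m\in\mathbb N$ with $\operatorname{Z}(G)\le m\le |V(G)|$. Then $$\operatorname{pt}_+(G,m)\le\left\lceil\frac{\operatorname{pt}(G,m)}{2}\right\rceil.$$
   Context: All graphs are finite, simple and undirected. Each vertex is blue or white; blue vertices stay blue. Standard rule: a blue vertex $u$ with exactly one white neighbor $v$ can force $v$ to become blue. PSD rule: if $B$ is the current set of blue vertices, $C$ is a connected component of $G-B$, and $u\in B$ satisfies $N_G(u)\cap V(C)=\{v\}$, then $u$ can force $v$ to become blue. For either rule and initial blue set $B$, put $B^{[0]}=B$, and let $B^{[k]}$ be the union of $B^{[k-1]}$ and the set of all vertices that can be forced by some vertex when exactly $B^{[k-1]}$ is blue. $B$ is a standard zero forcing set (resp. PSD forcing set) if $B^{[k]}=V(G)$ for some $k$ under the standard (resp. PSD) rule; the least such $k$ is $\operatorname{pt}(G,B)$ (resp. $\operatorname{pt}_+(G,B)$). $\operatorname{Z}(G)$ is the minimum size of a standard zero forcing set. $\operatorname{pt}(G,m)$ is the minimum of $\operatorname{pt}(G,B)$ over standard zero forcing sets $B$ with $|B|=m$, and $\operatorname{pt}_+(G,m)$ is the minimum of $\operatorname{pt}_+(G,B)$ over PSD forcing sets $B$ with $|B|=m$. -}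

module Defs where

open import Level using (0ℓ)
open import Data.Fin.Base using (Fin)
open import Data.Fin.Subset as Subset using (Subset; ∣_∣)
open import Data.Nat.Base using (ℕ; zero; suc; _≤_)
open import Data.Product using (∃; ∃-syntax; _×_)
open import Relation.Binary.Core using (Rel)
open import Relation.Binary.Construct.Closure.ReflexiveTransitive using (Star)
open import Relation.Binary.Definitions using (Decidable; Irreflexive; Symmetric)
open import Relation.Binary.PropositionalEquality.Core using (_≡_)
open import Relation.Unary using (Pred; _∈_; _∉_; _⊆_; _≐_; _∩_; _∪_; ∁; ｛_｝; Universal)

-- Decidability of adjacency is what finiteness of the edge set amounts to
-- constructively.
record Graph (n : ℕ) : Set₁ where
  field
    Adj        : Rel (Fin n) 0ℓ
    adjacent?  : Decidable Adj
    symmetric  : Symmetric Adj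
    irreflexive : Irreflexive _≡_ Adj

-- Sets of vertices arising during the process are predicates; only the
-- initial blue sets, whose cardinality matters, are of type Subset n.
VertexSet : ℕ → Set₁
VertexSet n = Pred (Fin n) 0ℓ

⟦_⟧ : ∀ {n} → Subset n → VertexSet n
⟦ B ⟧ v = v Subset.∈ B

-- A colour change rule: R G B u v says that u can force v when exactly the
-- vertices in B are blue.
Rule : Set₁
Rule = ∀ {n} → Graph n → VertexSet n → Rel (Fin n) 0ℓ

module _ {n} (G : Graph n) where
  open Graph G

  AdjOutside : VertexSet n → Rel (Fin n) 0ℓ
  AdjOutside B x y = x ∉ B × y ∉ B × Adj x y

  -- For w ∉ B, the vertex set of the connected component of G - B containing
  -- w.  For w ∈ B this is just {w}, so uses must require w ∉ B.
  Component : VertexSet n → Fin n → VertexSet n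
  Component B w = Star (AdjOutside B) w

standard : Rule
standard G B u v = u ∈ B × (Adj u ∩ ∁ B) ≐ ｛ v ｝
  where open Graph G

-- The components of G - B are indexed by their members w ∉ B.
psd : Rule
psd G B u v = u ∈ B × ∃[ w ] (w ∉ B × (Adj u ∩ Component G B w) ≐ ｛ v ｝)
  where open Graph G

module _ (R : Rule) {n} (G : Graph n) where

  blueAfter : ℕ → VertexSet n → VertexSet n
  blueAfter zero    B = B
  blueAfter (suc k) B = blueAfter k B ∪ λ v → ∃[ u ] R G (blueAfter k B) u v

  AllBlueAfter : Subset n → Pred ℕ 0ℓ
  AllBlueAfter B k = Universal (blueAfter k ⟦ B ⟧)

  IsForcingSet : Pred (Subset n) 0ℓ
  IsForcingSet B = ∃ (AllBlueAfter B)

IsMinimum : Pred ℕ 0ℓ → Pred ℕ 0ℓ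
IsMinimum P k = k ∈ P × P ⊆ (k ≤_)

-- The minima below are rendered as relations: a minimum over the empty set
-- does not exist, so e.g. IsPropagationTime has no solution t when B is not a
-- forcing set.
module _ (R : Rule) {n} (G : Graph n) where

  IsForcingNumber : Pred ℕ 0ℓ
  IsForcingNumber = IsMinimum λ k → ∃[ B ] (IsForcingSet R G B × ∣ B ∣ ≡ k)

  IsPropagationTime : Subset n → Pred ℕ 0ℓ
  IsPropagationTime B = IsMinimum (AllBlueAfter R G B)

  IsMinPropagationTime : ℕ → Pred ℕ 0ℓ
  IsMinPropagationTime m = IsMinimum λ t →
    ∃[ B ] (IsForcingSet R G B × ∣ B ∣ ≡ m × IsPropagationTime B t)

IsZ : ∀ {n} → Graph n → Pred ℕ 0ℓ
IsZ = IsForcingNumber standard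

IsPt : ∀ {n} → Graph n → ℕ → Pred ℕ 0ℓ
IsPt = IsMinPropagationTime standard

IsPt₊ : ∀ {n} → Graph n → ℕ → Pred ℕ 0ℓ
IsPt₊ = IsMinPropagationTime psd

{-# OPTIONS --safe #-}
-- For a standard forcing set B with blue sets K s = B^[s], move every vertex of
-- B along its forcing chain up to time s.  The resulting slice has the size of B
-- and separates K s from the rest of the graph: a vertex of K s off the slice
-- has all its neighbours in K s.  Hence, starting from the slice, the PSD rule
-- runs the original forces forward outside K s and, simultaneously and
-- independently, the reversed forces backward inside K s.  With s = ⌈ t /2⌉
-- both directions are finished after s steps.
module Submission where

open import Data.Fin.Base using (Fin; zero; suc)
open import Data.Fin.Properties as Fin using (_≟_; any?; all?)
open import Data.Fin.Subset as Subset using (Subset; inside; outside; ∣_∣; ⁅_⁆; ⊥)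
open import Data.Fin.Subset.Properties using
  (_∈?_; anySubset?; x∈⁅x⁆; x∈⁅y⁆⇒x≡y; x∈p∪q⁺; x∈p∪q⁻; ∉⊥; ∣⊥∣≡0; ∣p∣≤n; ∪-identityˡ)
open import Data.List.Base using (List; []; _∷_; allFin)
open import Data.List.Membership.Propositional using () renaming (_∈_ to _∈ˡ_)
open import Data.List.Membership.Propositional.Properties using (∈-allFin)
open import Data.List.Relation.Unary.Any using (here; there)
open import Data.Nat.Base using (ℕ; zero; suc; _+_; _≤_; z≤n; s≤s; ⌈_/2⌉)
open import Data.Nat.Properties as ℕ using
  (_≤?_; ≤-refl; ≤-antisym; ≰⇒>; +-suc; +-identityʳ;
   +-monoˡ-≤; m≤n+m; ⌊n/2⌋≤⌈n/2⌉; ⌊n/2⌋+⌈n/2⌉≡n; module ≤-Reasoning)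
open import Data.Product using (∃-syntax; _×_; _,_; proj₁; proj₂; uncurry)
open import Data.Sum.Base using (_⊎_; inj₁; inj₂; [_,_])
open import Data.Vec.Base using ([]; _∷_; here; there)
open import Function.Base using (_∘_; id)
open import Relation.Binary.Construct.Closure.ReflexiveTransitive using (Star; ε; _◅_; _◅◅_)
open import Relation.Binary.Core using (Rel)
import Relation.Binary.Definitions as Binary
open import Relation.Binary.PropositionalEquality using (_≡_; refl; sym; trans; cong; subst)
open import Relation.Nullary using (Dec; yes; no; contradiction)
open import Relation.Nullary.Decidable using (map′; ¬?; _×-dec_; _⊎-dec_; _→-dec_)
open import Relation.Unary using (Pred; Decidable; _∈_; _∉_; _⊆_; _≐_; ∁; ｛_｝)
open import Level using (0ℓ)
open import Defs

private
  variable
    n m : ℕ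

-- Decidability of reachability in a finite graph.

module _ {_∼_ : Rel (Fin n) 0ℓ} where

  -- Walks whose intermediate vertices lie in a list (Floyd–Warshall).
  Via : List (Fin n) → Rel (Fin n) 0ℓ
  Via []       x y = x ≡ y ⊎ x ∼ y
  Via (z ∷ zs) x y = Via zs x y ⊎ (Via zs x z × Via zs z y)

  via? : Binary.Decidable _∼_ → ∀ zs → Binary.Decidable (Via zs)
  via? _∼?_ []       x y = (x ≟ y) ⊎-dec (x ∼? y)
  via? _∼?_ (z ∷ zs) x y = via? _∼?_ zs x y ⊎-dec (via? _∼?_ zs x z ×-dec via? _∼?_ zs z y)

  via⇒star : ∀ zs {x y} → Via zs x y → Star _∼_ x y
  via⇒star []       (inj₁ refl)    = ε
  via⇒star []       (inj₂ x∼y)     = x∼y ◅ ε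
  via⇒star (z ∷ zs) (inj₁ p)       = via⇒star zs p
  via⇒star (z ∷ zs) (inj₂ (p , q)) = via⇒star zs p ◅◅ via⇒star zs q

  ≡⊎∼⇒via : ∀ zs {x y} → x ≡ y ⊎ x ∼ y → Via zs x y
  ≡⊎∼⇒via []       p = p
  ≡⊎∼⇒via (z ∷ zs) p = inj₁ (≡⊎∼⇒via zs p)

  -- Joining at a listed `w` needs no longer list because loops are cut out: those at `z` if `w` is
  -- `z`, and otherwise, when both halves visit `z`, the whole detour through `w` between these
  -- visits.
  via-trans : ∀ zs {x w y} → w ∈ˡ zs → Via zs x w → Via zs w y → Via zs x y
  via-trans (z ∷ zs) (here refl) p q = inj₂ ([ id , proj₁ ] p , [ id , proj₂ ] q)
  via-trans (z ∷ zs) (there w∈)  (inj₁ p)       (inj₁ q)       = inj₁ (via-trans zs w∈ p q)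
  via-trans (z ∷ zs) (there w∈)  (inj₁ p)       (inj₂ (q , r)) = inj₂ (via-trans zs w∈ p q , r)
  via-trans (z ∷ zs) (there w∈)  (inj₂ (p , q)) (inj₁ r)       = inj₂ (p , via-trans zs w∈ q r)
  via-trans (z ∷ zs) (there w∈)  (inj₂ (p , _)) (inj₂ (_ , r)) = inj₂ (p , r)

  star⇒via : ∀ {x y} → Star _∼_ x y → Via (allFin n) x y
  star⇒via ε         = ≡⊎∼⇒via (allFin n) (inj₁ refl)
  star⇒via (e ◅ es) =
    via-trans (allFin n) (∈-allFin _) (≡⊎∼⇒via (allFin n) (inj₂ e)) (star⇒via es)

  star? : Binary.Decidable _∼_ → Binary.Decidable (Star _∼_)
  star? _∼?_ x y = map′ (via⇒star (allFin n)) star⇒via (via? _∼?_ (allFin n) x y)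

-- Images of finite subsets, and supersets of prescribed size.

image : Subset n → (Fin n → Fin m) → Subset m
image []            f = ⊥
image (inside ∷ p)  f = ⁅ f zero ⁆ Subset.∪ image p (f ∘ suc)
image (outside ∷ p) f = image p (f ∘ suc)

∈-image⁺ : ∀ {p : Subset n} (f : Fin n → Fin m) {x} → x Subset.∈ p → f x Subset.∈ image p f
∈-image⁺ {p = inside  ∷ p} f here        = x∈p∪q⁺ (inj₁ (x∈⁅x⁆ _))
∈-image⁺ {p = inside  ∷ p} f (there x∈p) = x∈p∪q⁺ (inj₂ (∈-image⁺ (f ∘ suc) x∈p))
∈-image⁺ {p = outside ∷ p} f (there x∈p) = ∈-image⁺ (f ∘ suc) x∈p

∈-image⁻ : ∀ (p : Subset n) (f : Fin n → Fin m) {y} → y Subset.∈ image p f →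
           ∃[ x ] (x Subset.∈ p × f x ≡ y)
∈-image⁻ []            f y∈ = contradiction y∈ ∉⊥
∈-image⁻ (inside ∷ p)  f y∈ with x∈p∪q⁻ _ _ y∈
... | inj₁ y∈₁ = zero , here , sym (x∈⁅y⁆⇒x≡y _ y∈₁)
... | inj₂ y∈₂ with x , x∈p , eq ← ∈-image⁻ p (f ∘ suc) y∈₂ = suc x , there x∈p , eq
∈-image⁻ (outside ∷ p) f y∈ with x , x∈p , eq ← ∈-image⁻ p (f ∘ suc) y∈ = suc x , there x∈p , eq

∣⁅x⁆∪p∣ : ∀ (x : Fin n) (p : Subset n) → x Subset.∉ p → ∣ ⁅ x ⁆ Subset.∪ p ∣ ≡ suc ∣ p ∣
∣⁅x⁆∪p∣ zero    (inside  ∷ p) x∉p = contradiction here x∉p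
∣⁅x⁆∪p∣ zero    (outside ∷ p) x∉p = cong (suc ∘ ∣_∣) (∪-identityˡ p)
∣⁅x⁆∪p∣ (suc x) (inside  ∷ p) x∉p = cong suc (∣⁅x⁆∪p∣ x p (x∉p ∘ there))
∣⁅x⁆∪p∣ (suc x) (outside ∷ p) x∉p = ∣⁅x⁆∪p∣ x p (x∉p ∘ there)

∣image∣ : ∀ (p : Subset n) (f : Fin n → Fin m) →
          (∀ {x y} → x Subset.∈ p → y Subset.∈ p → f x ≡ f y → x ≡ y) → ∣ image p f ∣ ≡ ∣ p ∣
∣image∣ {m = m} []    f inj = ∣⊥∣≡0 m
∣image∣ (outside ∷ p) f inj =
  ∣image∣ p (f ∘ suc) λ x∈ y∈ eq → Fin.suc-injective (inj (there x∈) (there y∈) eq)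
∣image∣ (inside ∷ p)  f inj =
  trans (∣⁅x⁆∪p∣ (f zero) (image p (f ∘ suc)) fresh)
        (cong suc (∣image∣ p (f ∘ suc)
          λ x∈ y∈ eq → Fin.suc-injective (inj (there x∈) (there y∈) eq)))
  where
  fresh : f zero Subset.∉ image p (f ∘ suc)
  fresh f0∈ with x , x∈p , eq ← ∈-image⁻ p (f ∘ suc) f0∈ with () ← inj (there x∈p) here eq

-- Serves to pad a minimum zero forcing set to exactly `m` vertices.
⊆-extend : ∀ (p : Subset n) → ∣ p ∣ ≤ m → m ≤ n → ∃[ q ] (p Subset.⊆ q × ∣ q ∣ ≡ m)
⊆-extend [] _ z≤n = [] , id , refl
⊆-extend (inside ∷ p) (s≤s ∣p∣≤m) (s≤s m≤n) with q , p⊆q , eq ← ⊆-extend p ∣p∣≤m m≤n =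
  inside ∷ q , (λ { here → here ; (there x∈p) → there (p⊆q x∈p) }) , cong suc eq
⊆-extend {n = suc n} {m} (outside ∷ p) ∣p∣≤m m≤1+n with m ≤? n
... | yes m≤n with q , p⊆q , eq ← ⊆-extend p ∣p∣≤m m≤n =
  outside ∷ q , (λ { (there x∈p) → there (p⊆q x∈p) }) , eq
-- Here `m` is `suc n`, so the head must be taken and the tail filled completely.
... | no m≰n with refl ← ≤-antisym m≤1+n (≰⇒> m≰n)
             with q , p⊆q , eq ← ⊆-extend p (∣p∣≤n p) ≤-refl =
  inside ∷ q , (λ { (there x∈p) → there (p⊆q x∈p) }) , cong suc eq

-- Existence of the minima: bounded search and decidability of both rules.

least : ∀ {P : Pred ℕ 0ℓ} → Decidable P → ∀ k → P k → ∃[ t ] (IsMinimum P t × t ≤ k)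
least P? k Pk with P? 0
... | yes P0 = 0 , (P0 , λ _ → z≤n) , z≤n
least P? zero    Pk | no ¬P0 = contradiction Pk ¬P0
least P? (suc k) Pk | no ¬P0 with t , (Pt , min) , t≤k ← least (P? ∘ suc) k Pk =
  suc t , (Pt , λ { {zero} P0 → contradiction P0 ¬P0 ; {suc _} Pj → s≤s (min Pj) }) , s≤s t≤k

≐-singleton? : ∀ {P : VertexSet n} → Decidable P → ∀ v → Dec (P ≐ ｛ v ｝)
≐-singleton? P? v =
  map′ (λ (Pv , uniq) → (λ {x} → uniq x) , λ { refl → Pv }) (λ (P⊆ , ⊆P) → ⊆P refl , λ _ → P⊆)
       (P? v ×-dec all? λ x → P? x →-dec (v ≟ x))

DecidableRule : Rule → Set₁
DecidableRule R = ∀ {n} (G : Graph n) {B} → Decidable B → Binary.Decidable (R G B)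

abstract
  standard? : DecidableRule standard
  standard? G B? u v = B? u ×-dec ≐-singleton? (λ x → adjacent? u x ×-dec ¬? (B? x)) v
    where open Graph G

  psd? : DecidableRule psd
  psd? G {B} B? u v =
    B? u ×-dec any? λ w → ¬? (B? w) ×-dec ≐-singleton? (λ x → adjacent? u x ×-dec component? w x) v
    where
    open Graph G
    component? : Binary.Decidable (Component G B)
    component? = star? λ x y → ¬? (B? x) ×-dec ¬? (B? y) ×-dec adjacent? x y

module _ {R : Rule} (R? : DecidableRule R) (G : Graph n) where

  abstract
    blueAfter? : ∀ k {B} → Decidable B → Decidable (blueAfter R G k B)
    blueAfter? zero    B? = B?
    blueAfter? (suc k) B? v = blueAfter? k B? v ⊎-dec any? λ u → R? G (blueAfter? k B?) u v

  allBlueAfter? : ∀ B → Decidable (AllBlueAfter R G B)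
  allBlueAfter? B k = all? (blueAfter? k (_∈? B))

  -- The search runs over times by which some set of size `m` has finished. The least such time is
  -- the propagation time of its own witness, since a faster run of that witness would give a
  -- smaller time.
  minPropagationTime : ∀ {m} B k → ∣ B ∣ ≡ m → AllBlueAfter R G B k →
                       ∃[ t ] (IsMinPropagationTime R G m t × t ≤ k)
  minPropagationTime {m} B k ∣B∣≡m all
    with t , ((C , ∣C∣≡m , allC) , min) , t≤k ←
         least (λ j → anySubset? (λ C → (∣ C ∣ ℕ.≟ m) ×-dec allBlueAfter? C j)) k (B , ∣B∣≡m , all)
    = t
    , ( (C , (t , allC) , ∣C∣≡m , allC , λ allC′ → min (C , ∣C∣≡m , allC′))
      , λ (D , _ , ∣D∣≡m , allD , _) → min (D , ∣D∣≡m , allD) )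
    , t≤k

-- Monotonicity of the process, and a criterion for PSD forces.

blueAfter-mono-≤ : ∀ (R : Rule) (G : Graph n) {B j k} → j ≤ k → blueAfter R G j B ⊆ blueAfter R G k B
blueAfter-mono-≤ R G {k = zero}  z≤n v∈ = v∈
blueAfter-mono-≤ R G {j = j} {suc k} j≤1+k v∈ with j ≤? k
... | yes j≤k = inj₁ (blueAfter-mono-≤ R G j≤k v∈)
... | no  j≰k with refl ← ≤-antisym j≤1+k (≰⇒> j≰k) = v∈

-- Extra blue vertices only remove white neighbours, so a force on `v` stays available unless `v` is
-- blue already.
standard-mono-⊆ : ∀ (G : Graph n) k {B C} → Decidable C → B ⊆ C →
                  blueAfter standard G k B ⊆ blueAfter standard G k C
standard-mono-⊆ G zero    C? B⊆C v∈ = B⊆C v∈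
standard-mono-⊆ G (suc k) C? B⊆C (inj₁ v∈) = inj₁ (standard-mono-⊆ G k C? B⊆C v∈)
standard-mono-⊆ G (suc k) C? B⊆C {v} (inj₂ (u , u∈ , only , v-white))
  with blueAfter? standard? G k C? v
... | yes v∈ = inj₁ v∈
... | no  v∉ = inj₂
  ( u , standard-mono-⊆ G k C? B⊆C u∈
  , (λ (adj , x∉) → only (adj , x∉ ∘ standard-mono-⊆ G k C? B⊆C))
  , λ { refl → proj₁ (v-white refl) , v∉ } )

-- A force is valid if some union P of components of G - B contains only one
-- neighbour of u; the component of that neighbour need not be known.
psd-force : ∀ (G : Graph n) {B : VertexSet n} (P : VertexSet n) → let open Graph G in
            (∀ {x y} → x ∈ P → AdjOutside G B x y → y ∈ P) →
            ∀ {u v} → u ∈ B → v ∉ B → v ∈ P → Adj u v →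
            (∀ {x} → Adj u x → x ∉ B → x ∈ P → v ≡ x) → psd G B u v
psd-force G {B} P closed {u} {v} u∈B v∉B v∈P u~v only =
  u∈B , v , v∉B , (λ (adj , walk) → uncurry (only adj) (stays v∉B v∈P walk)) , λ { refl → u~v , ε }
  where
  stays : ∀ {x y} → x ∉ B → x ∈ P → Star (AdjOutside G B) x y → y ∉ B × y ∈ P
  stays x∉B x∈P ε = x∉B , x∈P
  stays x∉B x∈P (e@(_ , y∉B , _) ◅ es) = stays y∉B (closed x∈P e) es

-- One step along the forcing chains.

module _ (G : Graph n) {K : VertexSet n} (K? : Decidable K) where
  open Graph G

  private
    forcer : Fin n → Fin n
    forcer v with any? (λ u → standard? G K? u v)
    ... | yes (u , _) = u
    -- A dummy value: `Advance` also demands a force on `v`, which rules this case out.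
    ... | no _        = v

    forcer-forces : ∀ {u v} → standard G K u v → standard G K (forcer v) v
    forcer-forces {u} {v} f with any? (λ u → standard? G K? u v)
    ... | yes (_ , f′) = f′
    ... | no ¬f        = contradiction (u , f) ¬f

    Advance : Rel (Fin n) 0ℓ
    Advance u v = standard G K u v × forcer v ≡ u

    advance-any? : ∀ u → Dec (∃[ v ] Advance u v)
    advance-any? u = any? λ v → standard? G K? u v ×-dec (forcer v ≟ u)

  -- One step along the forcing chains.  Several vertices may be able to force
  -- the same vertex; only the selected forcer moves.
  advance : Fin n → Fin n
  advance u with advance-any? u
  ... | yes (v , _) = v
  ... | no _        = u

  forced-white : ∀ {u v} → standard G K u v → v ∉ K
  forced-white (_ , _ , v-white) = proj₂ (v-white refl)

  forced-adj : ∀ {u v} → standard G K u v → Adj u v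
  forced-adj (_ , _ , v-white) = proj₁ (v-white refl)

  private
    advance-cases : ∀ u → Advance u (advance u) ⊎ advance u ≡ u
    advance-cases u with advance-any? u
    ... | yes (_ , a) = inj₁ a
    ... | no _        = inj₂ refl

  advance-forces : ∀ u → standard G K u (advance u) ⊎ advance u ≡ u
  advance-forces u with advance-cases u
  ... | inj₁ (f , _) = inj₁ f
  ... | inj₂ eq      = inj₂ eq

  -- Where both vertices move, `forcer` recovers the start from the end. A moving and a resting
  -- vertex cannot meet, as one ends outside `K` and the other inside.
  advance-injective : ∀ {u v} → u ∈ K → v ∈ K → advance u ≡ advance v → u ≡ v
  advance-injective {u} {v} u∈K v∈K eq with advance-cases u | advance-cases v
  ... | inj₁ (_ , eq₁) | inj₁ (_ , eq₂) = trans (sym eq₁) (trans (cong forcer eq) eq₂)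
  ... | inj₂ eq₁       | inj₂ eq₂       = trans (sym eq₁) (trans eq eq₂)
  ... | inj₁ (f , _)   | inj₂ eq₂       =
    contradiction (subst K (sym (trans eq eq₂)) v∈K) (forced-white f)
  ... | inj₂ eq₁       | inj₁ (f , _)   =
    contradiction (subst K (trans (sym eq₁) eq) u∈K) (forced-white f)

  forced⇒advance : ∀ {u v} → standard G K u v → ∃[ w ] (standard G K w v × advance w ≡ v)
  forced⇒advance {u} {v} f = forcer v , g , lands
    where
    g = forcer-forces f
    lands : advance (forcer v) ≡ v
    lands with advance-any? (forcer v)
    -- `forcer v` has a single white neighbour, so the `x` found by the search is `v`.
    ... | yes (x , (_ , _ , x-white) , _) = sym (proj₁ (proj₂ g) (x-white refl))
    ... | no ¬a = contradiction (v , g , refl) ¬a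

-- Slices across the forcing chains, and how they separate the graph.

module Slices (G : Graph n) (B : Subset n) where
  open Graph G

  K : ℕ → VertexSet n
  K s = blueAfter standard G s ⟦ B ⟧

  K? : ∀ s → Decidable (K s)
  K? s = blueAfter? standard? G s (_∈? B)

  K-mono : ∀ {r s} → r ≤ s → K r ⊆ K s
  K-mono = blueAfter-mono-≤ standard G

  slice : ℕ → Subset n
  slice zero    = B
  slice (suc s) = image (slice s) (advance G (K? s))

  -- The vertices that have already forced.
  Past : ℕ → VertexSet n
  Past s v = v ∈ K s × v Subset.∉ slice s

  slice⊆K : ∀ s {v} → v Subset.∈ slice s → v ∈ K s
  slice⊆K zero    v∈ = v∈
  slice⊆K (suc s) v∈ with u , u∈ , refl ← ∈-image⁻ (slice s) _ v∈ with advance-forces G (K? s) u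
  ... | inj₁ f  = inj₂ (u , f)
  ... | inj₂ eq = inj₁ (subst (K s) (sym eq) (slice⊆K s u∈))

  ∣slice∣ : ∀ s → ∣ slice s ∣ ≡ ∣ B ∣
  ∣slice∣ zero    = refl
  ∣slice∣ (suc s) =
    trans (∣image∣ (slice s) _ λ u∈ v∈ → advance-injective G (K? s) (slice⊆K s u∈) (slice⊆K s v∈))
          (∣slice∣ s)

  -- A vertex that does not advance is its own image and remains on the slice.
  leaves-slice⇒forces : ∀ s {v} → v Subset.∈ slice s → v Subset.∉ slice (suc s) →
                        standard G (K s) v (advance G (K? s) v)
  leaves-slice⇒forces s {v} v∈ v∉ with advance-forces G (K? s) v
  ... | inj₁ f  = f
  ... | inj₂ eq = contradiction (subst (Subset._∈ slice (suc s)) eq (∈-image⁺ _ v∈)) v∉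

  -- A vertex leaves the slice only while forcing its sole white neighbour, after which all its
  -- neighbours are blue. The induction is mutual: the case `suc s` uses the two lemmas below at
  -- `s`, and these rely on the present one at `s`.
  past-neighbours : ∀ s {u v} → u ∈ Past s → Adj u v → v ∈ K s
  -- The selected forcer of `v` is still on `slice s`, for a past one would have no white neighbour;
  -- hence it advances onto `v`.
  newly-blue⇒slice : ∀ s {v} → v ∈ K (suc s) → v ∉ K s → v Subset.∈ slice (suc s)
  past-suc⇒K : ∀ s {v} → v ∈ Past (suc s) → v ∈ K s

  past-neighbours zero    (u∈ , u∉) _ = contradiction u∈ u∉
  past-neighbours (suc s) {u} {v} past@(_ , u∉slice) u~v with u ∈? slice s
  ... | no u∉ = inj₁ (past-neighbours s (past-suc⇒K s past , u∉) u~v)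
  ... | yes u∈ with K? s v
  ...   | yes v∈ = inj₁ v∈
  ...   | no  v∉ with f@(_ , only , _) ← leaves-slice⇒forces s u∈ u∉slice
                 with refl ← only (u~v , v∉) = inj₂ (u , f)

  newly-blue⇒slice s (inj₁ v∈)      v∉ = contradiction v∈ v∉
  newly-blue⇒slice s (inj₂ (_ , f)) v∉ with u , g@(u∈K , _) , refl ← forced⇒advance G (K? s) f
    with u ∈? slice s
  ... | yes u∈ = ∈-image⁺ _ u∈
  ... | no  u∉ = contradiction (past-neighbours s (u∈K , u∉) (forced-adj G (K? s) g)) v∉

  past-suc⇒K s {v} (v∈ , v∉slice) with K? s v
  ... | yes v∈K = v∈K
  ... | no  v∉K = contradiction (newly-blue⇒slice s v∈ v∉K) v∉slice

  -- The PSD process started from a slice.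

  module FromSlice (s : ℕ) where

    Blue : ℕ → VertexSet n
    Blue j = blueAfter psd G j ⟦ slice s ⟧

    Blue? : ∀ j → Decidable (Blue j)
    Blue? j = blueAfter? psd? G j (_∈? slice s)

    white⇒∉slice : ∀ j {v} → v ∉ Blue j → v Subset.∉ slice s
    white⇒∉slice j v∉ v∈ = v∉ (blueAfter-mono-≤ psd G {k = j} z≤n v∈)

    -- A white vertex of `K s` is off the slice, hence past. No edge between white vertices
    -- therefore crosses the border of `K s`, and both sides qualify as `P` in `psd-force`.
    K-closed : ∀ j {x y} → x ∈ K s → AdjOutside G (Blue j) x y → y ∈ K s
    K-closed j x∈ (x∉ , _ , x~y) = past-neighbours s (x∈ , white⇒∉slice j x∉) x~y

    ∁K-closed : ∀ j {x y} → x ∉ K s → AdjOutside G (Blue j) x y → y ∉ K s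
    ∁K-closed j x∉ (x-white , y-white , x~y) y∈ = x∉ (K-closed j y∈ (y-white , x-white , symmetric x~y))

    -- The original forces are replayed. A forcer `u` inside `K s` must lie on the slice, since it
    -- has the neighbour `v` outside `K s`. A PSD-white neighbour of `u` outside `K s` is, by
    -- induction, also white in the standard process, so it is `v`.
    forward : ∀ j {v} → v ∈ K (j + s) → v ∉ K s → v ∈ Blue j
    forward zero    v∈ v∉ = contradiction v∈ v∉
    forward (suc j) (inj₁ v∈) v∉ = inj₁ (forward j v∈ v∉)
    forward (suc j) {v} (inj₂ (u , f@(u∈ , only , _))) v∉ with Blue? j v
    ... | yes v∈Blue = inj₁ v∈Blue
    ... | no  v∉Blue = inj₂ (u , psd-force G (∁ (K s)) (∁K-closed j) u∈Blue v∉Blue v∉ u~v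
            λ u~x x-white x∉ → only (u~x , λ x∈ → x-white (forward j x∈ x∉)))
      where
      u~v = forced-adj G (K? (j + s)) f
      u∈Blue : u ∈ Blue j
      u∈Blue with K? s u
      ... | no  u∉K = forward j u∈ u∉K
      ... | yes u∈K with u ∈? slice s
      ...   | yes u∈slice = blueAfter-mono-≤ psd G {k = j} z≤n u∈slice
      ...   | no  u∉slice = contradiction (past-neighbours s (u∈K , u∉slice) u~v) v∉

    -- While `j` counts PSD steps, `r` is the time down to which the standard process has been
    -- undone. Each step reverses the forces made between times `r` and `suc r`; at `r = 0` no
    -- vertex is past.
    backward : ∀ j r → j + r ≡ s → ∀ {v} → v ∈ K s → v ∈ Blue j ⊎ v ∈ Past r
    backward zero    r refl {v} v∈ with v ∈? slice s
    ... | yes v∈slice = inj₁ v∈slice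
    ... | no  v∉slice = inj₂ (v∈ , v∉slice)
    backward (suc j) r 1+j+r≡s {v} v∈ with Blue? j v
    ... | yes v∈Blue = inj₁ (inj₁ v∈Blue)
    ... | no  v∉Blue = decide (white-past v∈ v∉Blue)
      where
      j+1+r≡s : j + suc r ≡ s
      j+1+r≡s = trans (+-suc j r) 1+j+r≡s

      white-past : ∀ {x} → x ∈ K s → x ∉ Blue j → x ∈ Past (suc r)
      white-past x∈ x∉ = [ (λ x∈Blue → contradiction x∈Blue x∉) , id ] (backward j (suc r) j+1+r≡s x∈)

      decide : v ∈ Past (suc r) → v ∈ Blue (suc j) ⊎ v ∈ Past r
      decide past@(_ , v∉next) with v ∈? slice r
      ... | no  v∉slice = inj₂ (past-suc⇒K r past , v∉slice)
      -- Between times `r` and `suc r` the vertex `v` forces `v′`, and this force is reversed. Lying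
      -- on `slice (suc r)`, `v′` is not past there, so by induction it is blue.
      ... | yes v∈slice = inj₁ (inj₂ (v′ , psd-force G (K s) (K-closed j) v′∈Blue v∉Blue v∈
                            (symmetric (forced-adj G (K? r) f)) only))
        where
        v′ = advance G (K? r) v
        f = leaves-slice⇒forces r v∈slice v∉next

        v′∈slice : v′ Subset.∈ slice (suc r)
        v′∈slice = ∈-image⁺ _ v∈slice

        v′∈Blue : v′ ∈ Blue j
        v′∈Blue with backward j (suc r) j+1+r≡s
                       (K-mono (subst (suc r ≤_) j+1+r≡s (m≤n+m (suc r) j)) (slice⊆K (suc r) v′∈slice))
        ... | inj₁ v′∈         = v′∈
        ... | inj₂ (_ , v′∉) = contradiction v′∈slice v′∉

        -- A white neighbour x of v′ in K s has not forced by time r, as v′ is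
        -- then white, but has by time r + 1; so it too forces v′ at that step.
        only : ∀ {x} → Adj v′ x → x ∉ Blue j → x ∈ K s → v ≡ x
        only {x} v′~x x-white x∈ with past′@(_ , x∉next) ← white-past x∈ x-white with x ∈? slice r
        ... | no  x∉slice = contradiction (past-neighbours r (past-suc⇒K r past′ , x∉slice) (symmetric v′~x))
                              (forced-white G (K? r) f)
        ... | yes x∈slice with (_ , only-x , _) ← leaves-slice⇒forces r x∈slice x∉next =
          advance-injective G (K? r) (slice⊆K r v∈slice) (slice⊆K r x∈slice)
            (sym (only-x (symmetric v′~x , forced-white G (K? r) f)))

    allBlueAfter : ∀ {t} → AllBlueAfter standard G B t → t ≤ s + s → AllBlueAfter psd G (slice s) s
    allBlueAfter all t≤2s v with K? s v
    -- `K (s + s)` contains `K t`, which is every vertex.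
    ... | no  v∉ = forward s (K-mono t≤2s (all v)) v∉
    ... | yes v∈ with backward s 0 (+-identityʳ s) v∈
    ...   | inj₁ v∈Blue     = v∈Blue
    -- `Past 0` is empty because both `K 0` and `slice 0` are `B`.
    ...   | inj₂ (v∈B , v∉B) = contradiction v∈B v∉B

-- Halving the propagation time.

n≤⌈n/2⌉+⌈n/2⌉ : ∀ k → k ≤ ⌈ k /2⌉ + ⌈ k /2⌉
n≤⌈n/2⌉+⌈n/2⌉ k = begin
  k                     ≡⟨ ⌊n/2⌋+⌈n/2⌉≡n k ⟨
  _                     ≤⟨ +-monoˡ-≤ ⌈ k /2⌉ (⌊n/2⌋≤⌈n/2⌉ k) ⟩
  ⌈ k /2⌉ + ⌈ k /2⌉     ∎
  where open ≤-Reasoning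

theorem4p9 : ∀ {n} (G : Graph n) (z m : ℕ) → IsZ G z → z ≤ m → m ≤ n →
    ∃[ t ] ∃[ t₊ ] (IsPt G m t × IsPt₊ G m t₊ × t₊ ≤ ⌈ t /2⌉)
theorem4p9 G z m ((A , (k , allA) , ∣A∣≡z) , _) z≤m m≤n
  with C , A⊆C , ∣C∣≡m ← ⊆-extend A (subst (_≤ m) (sym ∣A∣≡z) z≤m) m≤n
  -- `C` only guarantees that the minimum exists; the slice is taken for a set `B` attaining it.
  with t , isPt@((B , _ , ∣B∣≡m , allB , _) , _) , _ ←
       minPropagationTime standard? G C k ∣C∣≡m (λ v → standard-mono-⊆ G k (_∈? C) A⊆C (allA v))
  with t₊ , isPt₊ , t₊≤ ←
       minPropagationTime psd? G (Slices.slice G B ⌈ t /2⌉) ⌈ t /2⌉ (trans (Slices.∣slice∣ G B ⌈ t /2⌉) ∣B∣≡m)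
         (Slices.FromSlice.allBlueAfter G B ⌈ t /2⌉ allB (n≤⌈n/2⌉+⌈n/2⌉ t))
  = t , t₊ , isPt , isPt₊ , t₊≤
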